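{- Let $m \ge 12$ be an integer. Then there exists a hypergraph $H \in \mathcal{B}$ such that the hypergraph $H_{=m}$ (consisting of the edges of $H$ of size exactly $m$) has no $3$-shallow hitting set.
   Context: A hypergraph $H=(V,E)$ belongs to $\mathcal{B}$ if $V\subset\mathbb{R}^2$ is finite and every edge $e\in E$ is induced by a bottomless rectangle, i.e. can be written as $e=\{(x,y)\in V: x_0<x<x_1,\ y<y_0\}$ for some $x_0,x_1,y_0\in\mathbb{R}$. For a hypergraph $H$, $H_{=m}$ is the hypergraph on the same vertex set whose edges are the edges of $H$ of size exactly $m$. For a hypergraph $(V,E)$ and a positive integer $c$, a set $U\subseteq V$ is a $c$-shallow hitting set if $1\le |e\cap U|\le c$ for every edge $e\in E$. -}

module Defs where

open import Data.Nat using (ℕ; _≤_; _≟_)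
open import Data.Bool using (Bool; _∧_)
open import Data.Rational using (ℚ)
open import Data.Rational.Properties using (_<?_)
open import Data.Product using (_×_; _,_; Σ; ∃)
open import Data.Fin using (Fin)
open import Data.Fin.Subset using (Subset; _∩_; ∣_∣)
open import Data.Vec using (Vec; lookup; tabulate)
open import Data.List using (List; filter)
open import Data.List.Relation.Unary.All using (All)
open import Data.List.Membership.Propositional using (_∈_)
open import Relation.Nullary.Decidable using (⌊_⌋)
open import Relation.Binary.PropositionalEquality using (_≡_)
open import Function.Definitions using (Injective)

Point : Set
Point = ℚ × ℚ

BottomlessRect : Set
BottomlessRect = ℚ × ℚ × ℚ

inRect : BottomlessRect → Point → Bool
inRect (x₀ , x₁ , y₀) (x , y) = ⌊ x₀ <? x ⌋ ∧ ⌊ x <? x₁ ⌋ ∧ ⌊ y <? y₀ ⌋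

Hypergraph : ℕ → Set
Hypergraph n = List (Subset n)

induced : ∀ {n} → Vec Point n → BottomlessRect → Subset n
induced pos R = tabulate (λ i → inRect R (lookup pos i))

InB : ∀ {n} → Vec Point n → Hypergraph n → Set
InB pos E = Injective _≡_ _≡_ (lookup pos)
          × All (λ e → ∃ λ R → e ≡ induced pos R) E

sizeExactly : ∀ {n} → ℕ → Hypergraph n → Hypergraph n
sizeExactly m E = filter (λ e → ∣ e ∣ ≟ m) E

ShallowHittingSet : ∀ {n} → ℕ → Hypergraph n → Subset n → Set
ShallowHittingSet c E U = ∀ e → e ∈ E → (1 ≤ ∣ e ∩ U ∣) × (∣ e ∩ U ∣ ≤ c)

{-# OPTIONS --safe #-}
module Submission where

open import Defs
open import Data.Bool using (Bool; true; false; _∧_; if_then_else_)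
open import Data.Bool.Properties using (∧-zeroʳ)
open import Data.Empty using (⊥)
open import Data.Fin using (toℕ)
open import Data.Fin.Properties using (toℕ-injective)
open import Data.Fin.Subset using (Subset; _∩_; ∣_∣)
open import Data.Integer as ℤ using (+<+)
import Data.Integer.Properties as ℤ
open import Data.List using (List; []; _∷_; _++_; length; take; drop; map; upTo; cartesianProduct)
open import Data.List.Membership.Propositional using (_∈_)
open import Data.List.Membership.Propositional.Properties using (∈-map⁺; ∈-cartesianProduct⁺; ∈-upTo⁺; ∈-filter⁺)
open import Data.List.Properties using (++-monoid; ++-assoc; ++-identityʳ; length-++; length-++-≤ˡ; length-++-≤ʳ; length-take; length-drop; take++drop≡id; length-map; map-++; ∷-injective)
open import Data.List.Relation.Unary.All as All using (All; []; _∷_)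
import Data.List.Relation.Unary.All.Properties as All
open import Data.Nat using (ℕ; zero; suc; _+_; _*_; _∸_; _≤_; _<_; z≤n; s≤s; _≤?_; _<?_; _≟_; ⌊_/2⌋; ⌈_/2⌉)
open import Data.Nat.Coprimality using (1-coprimeTo) renaming (sym to coprime-sym)
open import Data.Nat.Properties
open import Data.Nat.Tactic.RingSolver using (solve-∀)
open import Data.Product using (Σ; ∃; ∃₂; _×_; _,_; proj₁; proj₂)
open import Data.Rational as ℚ using (ℚ; mkℚ)
import Data.Rational.Properties as ℚ
open import Data.Unit using (⊤; tt)
open import Data.Vec using (Vec; []; _∷_; lookup; tabulate; fromList)
open import Data.Vec.Properties using (lookup∘tabulate; tabulate-cong)
open import Function using (mk⇔; _⇔_)
open import Relation.Binary.PropositionalEquality using (_≡_; refl; sym; trans; cong; cong₂; subst; subst₂; module ≡-Reasoning)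
open import Relation.Nullary using (¬_; yes; no; contradiction; does)
open import Relation.Nullary.Decidable using (dec-true; dec-false; does-⇔; isYes≗does)
open import Tactic.MonoidSolver using () renaming (solve to solve-monoid)

-- Read y as the time at which a point is inserted into a row ordered by x: the edges of size m
-- are the blocks of m consecutive points that occur at some time. Colour the points of U with
-- ones. Inserting points directly to the left of a fixed row B produces many blocks that end
-- with the same initial part of B, so colourings in which B starts with many ones, or with many
-- zeros, die. Attacking all gaps of a row from left to right in this way shows that no part of
-- the row itself starts such a pattern. Bootstrapping these attacks, with h = ⌊m/2⌋ and
-- H = ⌈m/2⌉, bounds the distance between consecutive ones of any row: first by H + 1, from below
-- by h, from above by H, from below by h + 1, and finally from below by h + 2 > H.
-- The lower bounds come from blocks inserted late, which have to be hit in order to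
-- keep the ones around them apart; the improved upper bound comes from blocks inserted late which
-- cannot be hit, as the m points around them would have been free of ones before.

-- Reduces a linear inequality to a ring identity that the solver can close: `k` is the slack that
-- is left after the known inequality `u ≤ v` has been used.
by-slack : ∀ {a b u v} k → u ≤ v → a + v + k ≡ b + u → a ≤ b
by-slack {a} {b} {u} {v} k u≤v eq = +-cancelʳ-≤ v a b
  (≤-trans (m≤m+n (a + v) k) (≤-trans (≤-reflexive eq) (+-monoʳ-≤ b u≤v)))

-- Blocks of consecutive entries

ones : List Bool → ℕ
ones []          = 0
ones (true  ∷ l) = suc (ones l)
ones (false ∷ l) = ones l

ones-++ : ∀ l l′ → ones (l ++ l′) ≡ ones l + ones l′
ones-++ []          l′ = refl
ones-++ (true  ∷ l) l′ = cong suc (ones-++ l l′)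
ones-++ (false ∷ l) l′ = ones-++ l l′

ones-++₃ : ∀ a b c → ones (a ++ b ++ c) ≡ ones a + (ones b + ones c)
ones-++₃ a b c = trans (ones-++ a (b ++ c)) (cong (ones a +_) (ones-++ b c))

length-++₃ : ∀ (a b c : List Bool) → length (a ++ b ++ c) ≡ length a + (length b + length c)
length-++₃ a b c = trans (length-++ a) (cong (length a +_) (length-++ b))

first-one : ∀ l → 1 ≤ ones l → ∃₂ λ p s → l ≡ p ++ true ∷ s × ones p ≡ 0
first-one (true  ∷ l) _ = [] , l , refl , refl
first-one (false ∷ l) h with first-one l h
... | p , s , refl , z = false ∷ p , s , refl , z

last-one : ∀ l → 1 ≤ ones l → ∃₂ λ p s → l ≡ p ++ true ∷ s × ones s ≡ 0
last-one (b ∷ l) h with 1 ≤? ones l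
... | yes h′ with last-one l h′
...   | p , s , refl , z = b ∷ p , s , refl , z
last-one (true  ∷ l) h | no ¬h = [] , l , refl , n<1⇒n≡0 (≰⇒> ¬h)
last-one (false ∷ l) h | no ¬h = contradiction h ¬h

no-one : ∀ l → (∀ p s → l ≡ p ++ true ∷ s → ⊥) → ones l ≡ 0
no-one l h with ones l in eq
... | zero  = refl
... | suc _ with first-one l (subst (1 ≤_) (sym eq) (s≤s z≤n))
...   | p , s , l≡ , _ = contradiction l≡ (h p s)

infix 4 _⊑_
_⊑_ : List Bool → List Bool → Set
w ⊑ l = ∃₂ λ p s → l ≡ p ++ w ++ s

⊑-trans : ∀ {u v w} → u ⊑ v → v ⊑ w → u ⊑ w
⊑-trans {u} (p , s , refl) (p′ , s′ , refl) =
  p′ ++ p , s ++ s′ , lemma p′ p u s s′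
  where
  lemma : ∀ (a b c d e : List Bool) → a ++ (b ++ c ++ d) ++ e ≡ (a ++ b) ++ c ++ (d ++ e)
  lemma a b c d e = solve-monoid (++-monoid Bool)

⊑-++ʳ : ∀ {u v} w → u ⊑ v → u ⊑ v ++ w
⊑-++ʳ {u} w (p , s , refl) = p , s ++ w , trans (++-assoc p (u ++ s) w) (cong (p ++_) (++-assoc u s w))

⊑-++ˡ : ∀ {u v} w → u ⊑ v → u ⊑ w ++ v
⊑-++ˡ {u} w (p , s , refl) = w ++ p , s , sym (++-assoc w p (u ++ s))

⊑-refl : ∀ {u} → u ⊑ u
⊑-refl {u} = [] , [] , sym (++-identityʳ u)

⊑-prefix : ∀ u v → u ⊑ u ++ v
⊑-prefix u v = ⊑-++ʳ v ⊑-refl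

⊑-suffix : ∀ u v → v ⊑ u ++ v
⊑-suffix u v = ⊑-++ˡ u ⊑-refl

⊑-length : ∀ {u v} → u ⊑ v → length u ≤ length v
⊑-length {u} (p , s , refl) = ≤-trans (length-++-≤ˡ u) (length-++-≤ʳ (u ++ s) {p})

⊑-take : ∀ n (l : List Bool) → take n l ⊑ l
⊑-take n l = [] , drop n l , sym (take++drop≡id n l)

straddle : ∀ A p w u v → (w ++ u) ⊑ (A ++ (p ++ w) ++ u ++ v)
straddle A p w u v = A ++ p , v , lemma A p w u v
  where
  lemma : ∀ (a b c d e : List Bool) → a ++ (b ++ c) ++ d ++ e ≡ (a ++ b) ++ (c ++ d) ++ e
  lemma a b c d e = solve-monoid (++-monoid Bool)

-- Local bounds on the density of ones.

AtMost : ℕ → ℕ → List Bool → Set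
AtMost n c l = ∀ {w} → w ⊑ l → length w ≤ n → ones w ≤ c

AtLeast : ℕ → List Bool → Set
AtLeast n l = ∀ {w} → w ⊑ l → n ≤ length w → 1 ≤ ones w

AtLeast-⊑ : ∀ {n l l′} → l ⊑ l′ → AtLeast n l′ → AtLeast n l
AtLeast-⊑ l⊑l′ dense w⊑l = dense (⊑-trans w⊑l l⊑l′)

split-at : ∀ n (l : List Bool) → n ≤ length l → ∃₂ λ u v → l ≡ u ++ v × length u ≡ n
split-at n l n≤ = take n l , drop n l , sym (take++drop≡id n l) , trans (length-take n l) (m≤n⇒m⊓n≡m n≤)

split-at-end : ∀ n (l : List Bool) → n ≤ length l → ∃₂ λ u v → l ≡ u ++ v × length v ≡ n
split-at-end n l n≤ = take k l , drop k l , sym (take++drop≡id k l) ,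
  trans (length-drop k l) (m∸[m∸n]≡n n≤)
  where k = length l ∸ n

AtMost-double : ∀ {n l} → AtMost n 1 l → AtMost (n + n) 2 l
AtMost-double {n} sparse {w} w⊑l len = begin
  ones w                             ≡⟨ cong ones (take++drop≡id n w) ⟨
  ones (take n w ++ drop n w)        ≡⟨ ones-++ (take n w) _ ⟩
  ones (take n w) + ones (drop n w)  ≤⟨ +-mono-≤ (sparse (⊑-trans (⊑-take n w) w⊑l) l₁) (sparse (⊑-trans (subst (drop n w ⊑_) (take++drop≡id n w) (⊑-suffix (take n w) _)) w⊑l) l₂) ⟩
  2                                  ∎
  where
  open ≤-Reasoning
  l₁ = ≤-trans (≤-reflexive (length-take n w)) (m⊓n≤m n _)
  l₂ = ≤-trans (≤-reflexive (length-drop n w)) (≤-trans (∸-monoˡ-≤ n len) (≤-reflexive (m+n∸n≡m n n)))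

exists-one : ∀ {n l} → AtLeast n l → n ≤ length l → 1 ≤ ones l
exists-one dense len = dense ⊑-refl len

gap-short : ∀ {n l w} → AtLeast n l → w ⊑ l → ones w ≡ 0 → length w < n
gap-short {n} {l} {w} dense w⊑l z with n ≤? length w
... | yes n≤ = contradiction (subst (1 ≤_) z (dense w⊑l n≤)) λ ()
... | no  n≰ = ≰⇒> n≰

ones-≥ : ∀ {a l} c → AtLeast a l → c * a ≤ length l → c ≤ ones l
ones-≥ zero dense len = z≤n
ones-≥ {a} {l} (suc c) dense len with split-at a l (≤-trans (m≤m+n a _) len)
... | u , v , refl , refl = begin
  1 + c            ≤⟨ +-mono-≤ (dense (⊑-prefix u v) ≤-refl) (ones-≥ c (AtLeast-⊑ (⊑-suffix u v) dense) len′) ⟩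
  ones u + ones v  ≡⟨ ones-++ u v ⟨
  ones (u ++ v)    ∎
  where
  open ≤-Reasoning
  len′ : c * length u ≤ length v
  len′ = +-cancelˡ-≤ (length u) _ _ (≤-trans len (≤-reflexive (length-++ u)))

-- The first one appears among the first `a` entries, so `c * a` entries still follow it. These
-- contain `c` further ones, which makes `c + 1` ones in a block of length `c * a + 1`.
too-dense : ∀ {a l} c → AtLeast a l → AtMost (suc (c * a)) c l → suc c * a ≤ length l → ⊥
too-dense {a} {l} c dense sparse len with first-one l (exists-one dense (≤-trans (m≤m+n a _) len))
... | p , s , refl , z with split-at (c * a) s
    (by-slack 0 (+-mono-≤ (gap-short dense (⊑-prefix p _) z) (≤-trans len (≤-reflexive (length-++ p)))) (lemma (c * a) a (length p) (length s)))
  where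
  lemma : ∀ ca a p s → ca + (a + (p + suc s)) + 0 ≡ s + (suc p + (a + ca))
  lemma = solve-∀
... | s′ , s″ , refl , s′-len =
  <-irrefl refl (≤-trans (s≤s (ones-≥ c s′-dense (≤-reflexive (sym s′-len)))) (sparse in-l (≤-reflexive (cong suc s′-len))))
  where
  in-l : (true ∷ s′) ⊑ (p ++ true ∷ s′ ++ s″)
  in-l = p , s″ , refl
  s′-dense : AtLeast a s′
  s′-dense = AtLeast-⊑ (⊑-trans (⊑-suffix (true ∷ []) s′) in-l) dense

ones-mono : ∀ {u v} → u ⊑ v → ones u ≤ ones v
ones-mono {u} (p , s , refl) = subst (ones u ≤_) (sym (ones-++₃ p u s)) (≤-trans (m≤m+n _ _) (m≤n+m _ (ones p)))

extend : ∀ {n} p w s → length w ≤ n → n ≤ length (p ++ w ++ s) → ∃ λ w′ → w ⊑ w′ × w′ ⊑ p ++ w ++ s × length w′ ≡ n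
extend {n} [] w s w≤n n≤l = w ++ take k s , ⊑-prefix w _ ,
  ([] , drop k s , trans (cong (w ++_) (sym (take++drop≡id k s))) (sym (++-assoc w _ _))) ,
  trans (length-++ w) (trans (cong (length w +_) (trans (length-take k s) (m≤n⇒m⊓n≡m k≤))) (m+[n∸m]≡n w≤n))
  where
  k = n ∸ length w
  k≤ : k ≤ length s
  k≤ = m≤n+o⇒m∸n≤o n (length w) (≤-trans n≤l (≤-reflexive (length-++ w)))
extend {n} (x ∷ p) w s w≤n n≤l with n ≤? length (p ++ w ++ s)
... | no n≰ = x ∷ p ++ w ++ s , (x ∷ p , s , refl) , ⊑-refl , ≤-antisym (≰⇒> n≰) n≤l
... | yes n≤ with extend p w s w≤n n≤
... | w′ , w⊑w′ , w′⊑l , len = w′ , w⊑w′ , ⊑-++ˡ (x ∷ []) w′⊑l , len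

-- Insertion schedules

Coloured : Set
Coloured = List (ℕ × Bool)

times : Coloured → List ℕ
times = map proj₁

colours : Coloured → List Bool
colours = map proj₂

-- The strict comparison matches `y < y₀`: this is the row seen by rectangles of height `t`.
state : ℕ → Coloured → List Bool
state t []            = []
state t ((u , b) ∷ c) = if does (u <? t) then b ∷ state t c else state t c

state-++ : ∀ t c c′ → state t (c ++ c′) ≡ state t c ++ state t c′
state-++ t []            c′ = refl
state-++ t ((u , b) ∷ c) c′ with does (u <? t)
... | true  = cong (b ∷_) (state-++ t c c′)
... | false = state-++ t c c′

state-old : ∀ {t u b} c → u < t → state t ((u , b) ∷ c) ≡ b ∷ state t c
state-old {t} {u} {b} c u<t = cong (λ x → if x then b ∷ state t c else state t c) (dec-true (u <? t) u<t)

state-new : ∀ {t u b} c → t ≤ u → state t ((u , b) ∷ c) ≡ state t c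
state-new {t} {u} {b} c t≤u = cong (λ x → if x then b ∷ state t c else state t c) (dec-false (u <? t) (≤⇒≯ t≤u))

state-all : ∀ {t} c → All (_< t) (times c) → state t c ≡ colours c
state-all []            []       = refl
state-all ((u , b) ∷ c) (p ∷ ps) = trans (state-old c p) (cong (b ∷_) (state-all c ps))

state-none : ∀ {t} c → All (t ≤_) (times c) → state t c ≡ []
state-none []            []       = refl
state-none ((u , b) ∷ c) (p ∷ ps) = trans (state-new c p) (state-none c ps)

map-++⁻ : ∀ {A B : Set} (f : A → B) xs ys {zs} → map f zs ≡ xs ++ ys →
          ∃₂ λ as bs → zs ≡ as ++ bs × map f as ≡ xs × map f bs ≡ ys
map-++⁻ f []       ys {zs}     eq = [] , zs , refl , refl , eq
map-++⁻ f (x ∷ xs) ys {z ∷ zs} eq with ∷-injective eq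
... | fz≡x , eq′ with map-++⁻ f xs ys eq′
... | as , bs , refl , p , q = z ∷ as , bs , refl , cong₂ _∷_ fz≡x p , q

-- schedule k lists, from left to right, the insertion times of the points of a structure that
-- is started at time k directly to the left of some context.
record Structure : Set where
  no-eta-equality
  field
    schedule : ℕ → List ℕ
    finish   : ℕ → ℕ
    later    : ∀ k → k ≤ finish k
    during   : ∀ k → All (λ u → k ≤ u × u < finish k) (schedule k)

open Structure

widen : ∀ {a b a′ b′ l} → a′ ≤ a → b ≤ b′ → All (λ u → a ≤ u × u < b) l → All (λ u → a′ ≤ u × u < b′) l
widen a′≤a b≤b′ = All.map (λ (p , q) → ≤-trans a′≤a p , ≤-trans q b≤b′)

infixr 6 _⨾_
_⨾_ : Structure → Structure → Structure
schedule (S ⨾ S′) k = schedule S k ++ schedule S′ (finish S k)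
finish   (S ⨾ S′) k = finish S′ (finish S k)
later    (S ⨾ S′) k = ≤-trans (later S k) (later S′ _)
during   (S ⨾ S′) k = All.++⁺ (widen ≤-refl (later S′ _) (during S k)) (widen (later S k) ≤-refl (during S′ _))

-- The ends count as gaps too: one copy precedes each point of the list and a last copy follows them
-- all.
weave : List ℕ → Structure → ℕ → List ℕ
weave []      S k = schedule S k
weave (u ∷ l) S k = schedule S k ++ u ∷ weave l S (finish S k)

weave-finish : List ℕ → Structure → ℕ → ℕ
weave-finish []      S k = finish S k
weave-finish (u ∷ l) S k = weave-finish l S (finish S k)

weave-later : ∀ l S k → k ≤ weave-finish l S k
weave-later []      S k = later S k
weave-later (u ∷ l) S k = ≤-trans (later S k) (weave-later l S _)

weave-during : ∀ {k₀} l S k → k₀ ≤ k → All (λ u → k₀ ≤ u × u < k) l →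
               All (λ u → k₀ ≤ u × u < weave-finish l S k) (weave l S k)
weave-during []      S k k₀≤k [] = widen k₀≤k ≤-refl (during S k)
weave-during (u ∷ l) S k k₀≤k ((k₀≤u , u<k) ∷ ps) = All.++⁺ (widen k₀≤k (weave-later l S _) (during S k))
  ((k₀≤u , ≤-trans u<k (≤-trans (later S k) (weave-later l S _))) ∷
   weave-during l S (finish S k) (≤-trans k₀≤k (later S k)) (widen ≤-refl (later S k) ps))

-- After S, a copy of S′ is inserted into each gap of S. The gaps are processed from left to
-- right, so that the row to the right of a gap is intact when its turn comes.
infixr 5 _▷_
_▷_ : Structure → Structure → Structure
schedule (S ▷ S′) k = weave (schedule S k) S′ (finish S k)
finish   (S ▷ S′) k = weave-finish (schedule S k) S′ (finish S k)
later    (S ▷ S′) k = ≤-trans (later S k) (weave-later (schedule S k) S′ _)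
during   (S ▷ S′) k = weave-during (schedule S k) S′ _ (later S k) (during S k)

count-up : ℕ → ℕ → List ℕ
count-up k zero    = []
count-up k (suc n) = k ∷ count-up (suc k) n

count-up-during : ∀ k n → All (λ u → k ≤ u × u < k + n) (count-up k n)
count-up-during k zero    = []
count-up-during k (suc n) = (≤-refl , m<m+n k (s≤s z≤n)) ∷ widen (n≤1+n k) (≤-reflexive (sym (+-suc k n))) (count-up-during (suc k) n)

length-count-up : ∀ k n → length (count-up k n) ≡ n
length-count-up k zero    = refl
length-count-up k (suc n) = cong suc (length-count-up (suc k) n)

-- The block of length q next to the context grows from left to right; only then the block of
-- length t grows, to the left of it.
delayed : ℕ → ℕ → Structure
schedule (delayed t q) k = count-up (k + q) t ++ count-up k q
finish   (delayed t q) k = k + q + t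
later    (delayed t q) k = ≤-trans (m≤m+n k q) (m≤m+n _ t)
during   (delayed t q) k = All.++⁺ (widen (m≤m+n k q) ≤-refl (count-up-during (k + q) t)) (widen ≤-refl (m≤m+n _ t) (count-up-during k q))

state-count-up : ∀ k n {c} → times c ≡ count-up k n → ∀ p s → colours c ≡ p ++ s → state (k + length p) c ≡ p
state-count-up k n {c} eq [] s refl = state-none c (subst (All _) (sym eq) (All.map (λ (p , _) → ≤-trans (≤-reflexive (+-identityʳ k)) p) (count-up-during k n)))
state-count-up k (suc n) {(u , b) ∷ c} eq (x ∷ p) s eq′ with ∷-injective eq | ∷-injective eq′
... | refl , eq₁ | refl , eq₂ = trans (state-old c (m<m+n u (s≤s z≤n)))
  (cong (b ∷_) (trans (cong (λ t → state t c) (+-suc u (length p))) (state-count-up (suc u) n eq₁ p s eq₂)))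

length-colours : ∀ {c l} → times c ≡ l → length (colours c) ≡ length l
length-colours {c} refl = trans (length-map proj₂ c) (sym (length-map proj₁ c))

plain : ℕ → Structure
plain = delayed 0

late-blocks : ℕ → ℕ → ℕ → Structure
late-blocks n t q = plain n ⨾ delayed t q ⨾ delayed t q

late-runs : ℕ → ℕ → Structure
late-runs n t = plain n ⨾ delayed t 1 ⨾ delayed t 1 ⨾ delayed t 1

-- Excluding contexts `Crowded n 1` at every gap of a row puts consecutive ones of the row at
-- distance at least `n`; excluding `Empty n` puts them at distance at most `n`.
Crowded : ℕ → ℕ → List Bool → Set
Crowded n c B = ∃₂ λ u v → B ≡ u ++ v × length u ≤ n × c < ones u

Empty : ℕ → List Bool → Set
Empty n B = ∃₂ λ u v → B ≡ u ++ v × n ≤ length u × ones u ≡ 0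

-- Colourings that stay safe while a structure is inserted.

module _ (m : ℕ) where

  -- A row with fewer than `m` points has no block of size `m`, so nothing limits its ones yet. From
  -- `m` points on, every shorter block lies in one of size `m` and inherits the bound 3.
  Safe : List Bool → Set
  Safe l = AtLeast m l × (m ≤ length l → AtMost m 3 l)

  record Survives (S : Structure) (k : ℕ) (A : List Bool) (c : Coloured) (B : List Bool) : Set where
    constructor survives
    field
      scheduled : times c ≡ schedule S k
      safe      : ∀ t → k ≤ t → t ≤ finish S k → Safe (A ++ state t c ++ B)

  -- Until `S` is finished no point of `S′` is present; afterwards all points of `S` are, and they
  -- join the left context. Both structures therefore face the same `B`.
  ⨾-survives : ∀ {S S′ k A c B} → Survives (S ⨾ S′) k A c B →
               ∃₂ λ c₁ c₂ → c ≡ c₁ ++ c₂ × Survives S k A c₁ B × Survives S′ (finish S k) (A ++ colours c₁) c₂ B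
  ⨾-survives {S} {S′} {k} {A} {c} {B} (survives sch safe) with map-++⁻ proj₁ (schedule S k) _ sch
  ... | c₁ , c₂ , refl , eq₁ , eq₂ = c₁ , c₂ , refl ,
    survives eq₁ (λ t k≤t t≤ → subst Safe (cong (λ x → A ++ x ++ B) (before t t≤)) (safe t k≤t (≤-trans t≤ (later S′ _)))) ,
    survives eq₂ (λ t k≤t t≤ → subst Safe (after t k≤t) (safe t (≤-trans (later S k) k≤t) t≤))
    where
    before : ∀ t → t ≤ finish S k → state t (c₁ ++ c₂) ≡ state t c₁
    before t t≤ = trans (state-++ t c₁ c₂) (trans (cong (state t c₁ ++_)
      (state-none c₂ (subst (All _) (sym eq₂) (All.map (λ (p , _) → ≤-trans t≤ p) (during S′ _))))) (++-identityʳ _))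
    after : ∀ t → finish S k ≤ t → A ++ state t (c₁ ++ c₂) ++ B ≡ (A ++ colours c₁) ++ state t c₂ ++ B
    after t k≤t = begin
      A ++ state t (c₁ ++ c₂) ++ B           ≡⟨ cong (λ x → A ++ x ++ B) (state-++ t c₁ c₂) ⟩
      A ++ (state t c₁ ++ state t c₂) ++ B   ≡⟨ cong (λ x → A ++ (x ++ state t c₂) ++ B) (state-all c₁ (subst (All _) (sym eq₁) (All.map (λ (_ , q) → ≤-trans q k≤t) (during S k)))) ⟩
      A ++ (colours c₁ ++ state t c₂) ++ B   ≡⟨ lemma A (colours c₁) (state t c₂) B ⟩
      (A ++ colours c₁) ++ state t c₂ ++ B   ∎
      where
      open ≡-Reasoning
      lemma : ∀ (a b c d : List Bool) → a ++ (b ++ c) ++ d ≡ (a ++ b) ++ c ++ d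
      lemma a b c d = solve-monoid (++-monoid Bool)

  -- Induction over the gaps from the left: the copy in the first gap and the point behind it are
  -- absorbed into the left context. All points of `l` are present from time `k` on while the gaps
  -- further right are still unfilled, so each copy sees exactly a suffix of the row followed by
  -- `B`.
  weave-survives : ∀ {k₀} l {S k A c B} → k₀ ≤ k → All (λ u → k₀ ≤ u × u < k) l → times c ≡ weave l S k →
    (∀ t → k ≤ t → t ≤ weave-finish l S k → Safe (A ++ state t c ++ B)) →
    ∃ λ c′ → times c′ ≡ l × (∀ t → t ≤ k → state t c ≡ state t c′) ×
      (∀ p q → colours c′ ≡ p ++ q → ∃₂ λ k′ A′ → ∃ λ d → Survives S k′ A′ d (q ++ B))
  weave-survives [] {S} {k} {A} {c} {B} k₀≤k [] sch safe = [] , refl ,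
    (λ t t≤k → state-none c (subst (All _) (sym sch) (All.map (λ (p , _) → ≤-trans t≤k p) (during S k)))) ,
    λ { [] [] refl → k , A , c , survives sch safe }
  weave-survives {k₀} (u ∷ l) {S} {k} {A} {c} {B} k₀≤k ((k₀≤u , u<k) ∷ ps) sch safe
    with map-++⁻ proj₁ (schedule S k) _ sch
  ... | d , (u , b) ∷ e , refl , eq₁ , eq₂ with ∷-injective eq₂
  ... | refl , eq₃ = result (weave-survives l {S} {finish S k} {A ++ colours d ++ b ∷ []} {e} {B}
      (≤-trans k₀≤k (later S k)) (widen ≤-refl (later S k) ps) eq₃
      (λ t f≤t t≤ → subst Safe (after t f≤t) (safe t (≤-trans (later S k) f≤t) t≤)))
    where
    open ≡-Reasoning
    lemma : ∀ (a b c d e : List Bool) → a ++ (b ++ c ++ d) ++ e ≡ (a ++ b ++ c) ++ d ++ e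
    lemma a b c d e = solve-monoid (++-monoid Bool)
    shown : ∀ t → k ≤ t → state t (d ++ (u , b) ∷ e) ≡ state t d ++ b ∷ state t e
    shown t k≤t = trans (state-++ t d _) (cong (state t d ++_) (state-old e (≤-trans u<k k≤t)))
    after : ∀ t → finish S k ≤ t → A ++ state t (d ++ (u , b) ∷ e) ++ B ≡ (A ++ colours d ++ b ∷ []) ++ state t e ++ B
    after t f≤t = begin
      A ++ state t (d ++ (u , b) ∷ e) ++ B         ≡⟨ cong (λ x → A ++ x ++ B) (shown t (≤-trans (later S k) f≤t)) ⟩
      A ++ (state t d ++ b ∷ state t e) ++ B       ≡⟨ cong (λ x → A ++ (x ++ b ∷ state t e) ++ B) (state-all d (subst (All _) (sym eq₁) (All.map (λ (_ , q) → ≤-trans q f≤t) (during S k)))) ⟩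
      A ++ (colours d ++ b ∷ state t e) ++ B       ≡⟨ lemma A (colours d) (b ∷ []) (state t e) B ⟩
      (A ++ colours d ++ b ∷ []) ++ state t e ++ B ∎
    result : (∃ λ c′ → times c′ ≡ l × (∀ t → t ≤ finish S k → state t e ≡ state t c′) ×
               (∀ p q → colours c′ ≡ p ++ q → ∃₂ λ k′ A′ → ∃ λ d → Survives S k′ A′ d (q ++ B))) →
             ∃ λ c′ → times c′ ≡ u ∷ l × (∀ t → t ≤ k → state t (d ++ (u , b) ∷ e) ≡ state t c′) ×
               (∀ p q → colours c′ ≡ p ++ q → ∃₂ λ k′ A′ → ∃ λ d → Survives S k′ A′ d (q ++ B))
    result (c′ , eq₄ , same , rest) = (u , b) ∷ c′ , cong (u ∷_) eq₄ , same′ , λ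
      { []      q refl → k , A , d , survives eq₁ (λ t k≤t t≤f → subst Safe (now t k≤t t≤f) (safe t k≤t (≤-trans t≤f (weave-later l S _))))
      ; (x ∷ p) q eq   → rest p q (proj₂ (∷-injective eq)) }
      where
      same′ : ∀ t → t ≤ k → state t (d ++ (u , b) ∷ e) ≡ state t ((u , b) ∷ c′)
      same′ t t≤k = trans (state-++ t d _) (trans
        (cong (_++ state t ((u , b) ∷ e)) (state-none d (subst (All _) (sym eq₁) (All.map (λ (p , _) → ≤-trans t≤k p) (during S k)))))
        (cong (λ x → if does (u <? t) then b ∷ x else x) (same t (≤-trans t≤k (later S k)))))
      now : ∀ t → k ≤ t → t ≤ finish S k → A ++ state t (d ++ (u , b) ∷ e) ++ B ≡ A ++ state t d ++ b ∷ colours c′ ++ B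
      now t k≤t t≤f = begin
        A ++ state t (d ++ (u , b) ∷ e) ++ B      ≡⟨ cong (λ x → A ++ x ++ B) (shown t k≤t) ⟩
        A ++ (state t d ++ b ∷ state t e) ++ B    ≡⟨ cong (A ++_) (++-assoc (state t d) _ B) ⟩
        A ++ state t d ++ b ∷ state t e ++ B      ≡⟨ cong (λ x → A ++ state t d ++ b ∷ x ++ B) (trans (same t t≤f) (state-all c′ (subst (All _) (sym eq₄) (All.map (λ (_ , q) → ≤-trans q k≤t) ps)))) ⟩
        A ++ state t d ++ b ∷ colours c′ ++ B     ∎

  ▷-survives : ∀ {S S′ k A c B} → Survives (S ▷ S′) k A c B →
    ∃ λ c′ → Survives S k A c′ B × (∀ p q → colours c′ ≡ p ++ q → ∃₂ λ k′ A′ → ∃ λ d → Survives S′ k′ A′ d (q ++ B))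
  ▷-survives {S} {S′} {k} {A} {c} {B} (survives sch safe)
    with weave-survives (schedule S k) {A = A} (later S k) (during S k) sch (λ t f≤t → safe t (≤-trans (later S k) f≤t))
  ... | c′ , eq , same , rest = c′ ,
    survives eq (λ t k≤t t≤f → subst (λ x → Safe (A ++ x ++ B)) (same t t≤f) (safe t k≤t (≤-trans t≤f (weave-later (schedule S k) S′ _)))) , rest

  -- Since both blocks grow from left to right, the intermediate rows contain exactly the prefixes
  -- of `Q` and then, with `Q` complete, those of `X`. These are the moments that the attacks
  -- exploit.
  delayed-survives : ∀ {t q k A c B} → Survives (delayed t q) k A c B →
    ∃₂ λ X Q → colours c ≡ X ++ Q × length X ≡ t × length Q ≡ q ×
      (∀ p s → Q ≡ p ++ s → Safe (A ++ p ++ B)) × (∀ p s → X ≡ p ++ s → Safe (A ++ p ++ Q ++ B))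
  delayed-survives {t} {q} {k} {A} {c} {B} (survives sch safe) with map-++⁻ proj₁ (count-up (k + q) t) _ sch
  ... | x , y , refl , eq₁ , eq₂ = colours x , colours y , map-++ proj₂ x y , lx , ly , early , late
    where
    lx = trans (length-colours eq₁) (length-count-up (k + q) t)
    ly = trans (length-colours eq₂) (length-count-up k q)
    length-≤ : ∀ {l n} (p s : List Bool) → l ≡ p ++ s → length l ≡ n → length p ≤ n
    length-≤ p s refl refl = ≤-trans (m≤m+n _ _) (≤-reflexive (sym (length-++ p)))
    early : ∀ p s → colours y ≡ p ++ s → Safe (A ++ p ++ B)
    early p s eq = subst (λ z → Safe (A ++ z ++ B)) same (safe (k + length p) (m≤m+n k _) (≤-trans p≤ (m≤m+n (k + q) t)))
      where
      p≤ = +-monoʳ-≤ k (length-≤ p s eq ly)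
      same : state (k + length p) (x ++ y) ≡ p
      same = trans (state-++ _ x y) (cong₂ _++_
        (state-none x (subst (All _) (sym eq₁) (All.map (λ (r , _) → ≤-trans p≤ r) (count-up-during (k + q) t))))
        (state-count-up k q eq₂ p s eq))
    late : ∀ p s → colours x ≡ p ++ s → Safe (A ++ p ++ colours y ++ B)
    late p s eq = subst (λ z → Safe (A ++ z)) same (safe (k + q + length p) (≤-trans (m≤m+n k q) (m≤m+n (k + q) _)) (+-monoʳ-≤ (k + q) (length-≤ p s eq lx)))
      where
      same : state (k + q + length p) (x ++ y) ++ B ≡ p ++ colours y ++ B
      same = trans (cong (_++ B) (trans (state-++ _ x y) (cong₂ _++_
        (state-count-up (k + q) t eq₁ p s eq)
        (state-all y (subst (All _) (sym eq₂) (All.map (λ (_ , r) → ≤-trans r (m≤m+n (k + q) _)) (count-up-during k q)))))))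
        (++-assoc p (colours y) B)

  -- Attacks on the right context and how they combine.

  Beats : Structure → (List Bool → Set) → Set
  Beats S 𝒫 = ∀ {k A c B} → Survives S k A c B → 𝒫 B → ⊥

  -- Composition serves to join two attacks into one: the result beats whatever either of them
  -- beats.
  beats-⨾ˡ : ∀ {S S′ 𝒫} → Beats S 𝒫 → Beats (S ⨾ S′) 𝒫
  beats-⨾ˡ {S} {S′} beats sv with ⨾-survives {S} {S′} sv
  ... | _ , _ , _ , sv₁ , _ = beats sv₁

  beats-⨾ʳ : ∀ {S S′ 𝒫} → Beats S′ 𝒫 → Beats (S ⨾ S′) 𝒫
  beats-⨾ʳ {S} {S′} beats sv with ⨾-survives {S} {S′} sv
  ... | _ , _ , _ , _ , sv₂ = beats sv₂

  beats-crowded-≤ : ∀ {S n n′ c} → n ≤ n′ → Beats S (Crowded n′ c) → Beats S (Crowded n c)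
  beats-crowded-≤ n≤n′ beats sv (u , v , eq , len , cr) = beats sv (u , v , eq , ≤-trans len n≤n′ , cr)

  Resists : Structure → List Bool → List Bool → Set
  Resists S l B = ∀ p q → l ≡ p ++ q → ∃₂ λ k A → ∃ λ c → Survives S k A c (q ++ B)

  -- A block with too many ones would begin a suffix of the row, and the copy of `S` in the gap
  -- before it would face a crowded context.
  resists-sparse : ∀ {S n c l B} → Beats S (Crowded n c) → Resists S l B → AtMost n c l
  resists-sparse {c = c} {B = B} beats res {w} (p , s , eq) len with ones w ≤? c
  ... | yes w≤ = w≤
  ... | no  w≰ with res p (w ++ s) eq
  ... | _ , _ , _ , sv = contradiction (w , s ++ B , ++-assoc w s B , len , ≰⇒> w≰) (beats sv)

  resists-dense : ∀ {S n l B} → Beats S (Empty n) → Resists S l B → AtLeast n l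
  resists-dense {B = B} beats res {w} (p , s , eq) len with ones w in z
  ... | suc _ = s≤s z≤n
  ... | zero with res p (w ++ s) eq
  ... | _ , _ , _ , sv = contradiction (w , s ++ B , ++-assoc w s B , len , z) (beats sv)

  -- The individual attacks: plain rows, late blocks and late runs.

  plain-survives : ∀ {n k A c B} → Survives (plain n) k A c B →
    length (colours c) ≡ n × (∀ p s → colours c ≡ p ++ s → Safe (A ++ p ++ B))
  plain-survives {n} sv with delayed-survives {0} {n} sv
  ... | [] , Q , eq , _ , len , early , _ = trans (cong length eq) len , λ p s eq′ → early p s (trans (sym eq) eq′)

  -- As soon as `m` points are present, a new one next to `B` completes a block of at most `m`
  -- points with four ones. Hence the second `m` points are all zeros and form a block that is not
  -- hit.
  plain-beats-crowded : ∀ {n} → n < m → Beats (plain (m + m)) (Crowded n 2)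
  plain-beats-crowded {n} n<m {A = A} {c} sv (u , v , refl , len , cr) with plain-survives {m + m} sv
  ... | Q-len , safe with split-at m (colours c) (≤-trans (m≤m+n m m) (≤-reflexive (sym Q-len)))
  ... | Q₁ , Q₂ , eq , Q₁-len = contradiction (subst (1 ≤_) Q₂-zero (proj₁ (safe (colours c) [] (sym (++-identityʳ _))) Q₂⊑ (≤-reflexive (sym Q₂-len)))) λ ()
    where
    Q₂-len : length Q₂ ≡ m
    Q₂-len = +-cancelˡ-≡ m _ _ (trans (cong (_+ length Q₂) (sym Q₁-len)) (trans (sym (length-++ Q₁)) (trans (cong length (sym eq)) Q-len)))
    Q₂⊑ : Q₂ ⊑ (A ++ colours c ++ u ++ v)
    Q₂⊑ = ⊑-++ˡ A (⊑-++ʳ (u ++ v) (subst (Q₂ ⊑_) (sym eq) (⊑-suffix Q₁ Q₂)))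
    lemma : ∀ (a b c d : List Bool) → a ++ b ++ c ++ d ≡ ((a ++ b) ++ c) ++ d
    lemma a b c d = solve-monoid (++-monoid Bool)
    Q₂-zero : ones Q₂ ≡ 0
    Q₂-zero = no-one Q₂ λ p s eq′ → <⇒≱ (s≤s cr)
      (proj₂ (safe ((Q₁ ++ p) ++ true ∷ []) s (trans eq (trans (cong (Q₁ ++_) eq′) (lemma Q₁ p (true ∷ []) s))))
        (big p)
        (straddle A (Q₁ ++ p) (true ∷ []) u v) (≤-trans (s≤s len) n<m))
      where
      big : ∀ p → m ≤ length (A ++ ((Q₁ ++ p) ++ true ∷ []) ++ u ++ v)
      big p = ≤-trans (≤-reflexive (sym Q₁-len)) (⊑-length (⊑-++ˡ A (⊑-++ʳ (u ++ v) (⊑-++ʳ (true ∷ []) (⊑-prefix Q₁ p)))))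

  -- When the last point of a block has just been inserted, the block is adjacent to the zeros of
  -- `B`, and together they have at least `m` points.
  plain-dense : ∀ {n w z k A c B} → Survives (plain n) k A c B → Empty z B → m ≤ w + z → AtLeast w (colours c)
  plain-dense {n} {A = A} sv (u , v , refl , len , u-zero) m≤ {x} (p , s , eq) x-len = begin
    1                 ≤⟨ proj₁ (proj₂ (plain-survives {n} sv) (p ++ x) s (trans eq (sym (++-assoc p x s)))) (straddle A p x u v)
                         (≤-trans m≤ (≤-trans (+-mono-≤ x-len len) (≤-reflexive (sym (length-++ x))))) ⟩
    ones (x ++ u)     ≡⟨ ones-++ x u ⟩
    ones x + ones u   ≡⟨ cong (ones x +_) u-zero ⟩
    ones x + 0        ≡⟨ +-identityʳ (ones x) ⟩
    ones x            ∎
    where open ≤-Reasoning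

  -- The zeros of `B` force a one into any `w` consecutive points of the new row, while `S` forbids
  -- three ones among `2 * w + 1`.
  plain-beats-empty : ∀ {S w z} → Beats S (Crowded (suc (2 * w)) 2) → m ≤ w + z → Beats (plain (3 * w) ▷ S) (Empty z)
  plain-beats-empty {S} {w} beats m≤ sv empty with ▷-survives {plain (3 * w)} {S} sv
  ... | c , line , res = too-dense 2 (plain-dense {3 * w} line empty m≤) (resists-sparse {S} beats res)
    (≤-reflexive (sym (proj₁ (plain-survives {3 * w} line))))

  -- Before X was inserted, the last one of Y and the first one of Q were close enough to
  -- form a block of length m with four ones together with the beginning of B.
  late-block-hit : ∀ {a n A Y X Q B} → AtLeast a (Y ++ X ++ Q) → a ≤ length Y → a ≤ length Q → m ≤ length (A ++ Y) →
    (∀ p s → Q ≡ p ++ s → Safe ((A ++ Y) ++ p ++ B)) → Crowded n 1 B → a + suc n ≤ m + length X → 1 ≤ ones X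
  late-block-hit {a} {n} {A} {Y} {X} {Q} dense Y-len Q-len m≤ safe (u , v , refl , len , cr) slack with ones X in X-zero
  ... | suc _ = s≤s z≤n
  ... | zero with last-one Y (exists-one (AtLeast-⊑ (⊑-prefix Y (X ++ Q)) dense) Y-len)
  ... | p , z , refl , z-zero with first-one Q (exists-one (AtLeast-⊑ (⊑-++ˡ Y (⊑-suffix X Q)) dense) Q-len)
  ... | r , s , refl , r-zero = contradiction
    (proj₂ (safe (r ++ true ∷ []) s (sym (++-assoc r (true ∷ []) s))) (≤-trans m≤ (⊑-length (⊑-prefix (A ++ Y) _))) block⊑ block-len)
    (<⇒≱ block-ones)
    where
    gap = z ++ X ++ r
    gap-zero : ones gap ≡ 0
    gap-zero = trans (ones-++₃ z X r) (cong₂ _+_ z-zero (cong₂ _+_ X-zero r-zero))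
    gap⊑ : gap ⊑ (p ++ true ∷ z) ++ X ++ r ++ true ∷ s
    gap⊑ = p ++ true ∷ [] , true ∷ s , lemma p (true ∷ []) z X r (true ∷ s)
      where
      lemma : ∀ (a b c d e f : List Bool) → (a ++ (b ++ c)) ++ d ++ e ++ f ≡ (a ++ b) ++ (c ++ d ++ e) ++ f
      lemma a b c d e f = solve-monoid (++-monoid Bool)
    block = true ∷ z ++ r ++ true ∷ u
    block⊑ : block ⊑ (A ++ p ++ true ∷ z) ++ (r ++ true ∷ []) ++ u ++ v
    block⊑ = A ++ p , v , lemma A p (true ∷ z) r (true ∷ []) u v
      where
      lemma : ∀ (a b c d e f g : List Bool) → (a ++ (b ++ c)) ++ (d ++ e) ++ f ++ g ≡ (a ++ b) ++ (c ++ d ++ (e ++ f)) ++ g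
      lemma a b c d e f g = solve-monoid (++-monoid Bool)
    block-len : length block ≤ m
    -- The zero run around `X` has fewer than `a` entries; leaving out `X` saves exactly the
    -- `length X` that `slack` allows for.
    block-len = by-slack 0 (+-mono-≤ (+-mono-≤ (subst (_< a) (length-++₃ z X r) (gap-short dense gap⊑ gap-zero)) len) slack)
      (trans (cong (λ x → suc x + (a + n + (m + length X)) + 0) (length-++₃ z r (true ∷ u))) (lemma (length z) (length r) (length u) (length X) a n m))
      where
      lemma : ∀ z r u x a n m → suc (z + (r + suc u)) + (a + n + (m + x)) + 0 ≡ m + (suc (z + (x + r)) + u + (a + suc n))
      lemma = solve-∀
    block-ones : 3 < ones block
    block-ones = subst (λ x → 3 < suc x) (sym (trans (ones-++₃ z r (true ∷ u)) (cong₂ _+_ z-zero (cong (_+ suc (ones u)) r-zero)))) (s≤s (s≤s cr))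

  -- Both late blocks are hit, and so is the block between them.
  late-blocks-beat-crowded : ∀ {S a s t q n} → Beats S (Empty a) → (∀ {l B} → Resists S l B → AtMost s 2 l) →
    a ≤ q → t + (q + t) ≤ s → a + suc n ≤ m + t → Beats (late-blocks (a + m) t q ▷ S) (Crowded n 1)
  late-blocks-beat-crowded {S} {a} {s} {t} {q} {n} beats sparse a≤q s≥ slack {A = A} sv crowded
    with ▷-survives {late-blocks (a + m) t q} {S} sv
  ... | c , line , res with ⨾-survives {plain (a + m)} {delayed t q ⨾ delayed t q} line
  ... | c₀ , _ , refl , line₀ , line₁₂ with ⨾-survives {delayed t q} {delayed t q} line₁₂
  ... | c₁ , c₂ , refl , line₁ , line₂
    with plain-survives {a + m} line₀ | delayed-survives {t} {q} line₁ | delayed-survives {t} {q} line₂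
  ... | len₀ , _ | X₁ , Q₁ , eq₁ , X₁-len , Q₁-len , safe₁ , _ | X₂ , Q₂ , eq₂ , X₂-len , Q₂-len , safe₂ , _ = <⇒≱ three-ones
    (sparse res window⊑ (≤-trans (≤-reflexive (trans (length-++₃ X₁ Q₁ X₂) (cong₂ _+_ X₁-len (cong₂ _+_ Q₁-len X₂-len)))) s≥))
    where
    L = colours (c₀ ++ c₁ ++ c₂)
    L≡ : L ≡ colours c₀ ++ colours c₁ ++ colours c₂
    L≡ = trans (map-++ proj₂ c₀ _) (cong (colours c₀ ++_) (map-++ proj₂ c₁ c₂))
    dense : AtLeast a L
    dense = resists-dense {S} beats res
    ⊑₁ : (colours c₀ ++ X₁ ++ Q₁) ⊑ L
    ⊑₁ = [] , colours c₂ , trans L≡ (trans (cong (λ x → colours c₀ ++ x ++ colours c₂) eq₁) (sym (++-assoc (colours c₀) _ _)))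
    ⊑₂ : (colours c₁ ++ X₂ ++ Q₂) ⊑ L
    ⊑₂ = subst (_⊑ L) (cong (colours c₁ ++_) eq₂) (subst (_ ⊑_) (sym L≡) (⊑-suffix (colours c₀) _))
    window⊑ : (X₁ ++ Q₁ ++ X₂) ⊑ L
    window⊑ = colours c₀ , Q₂ , trans L≡ (cong (colours c₀ ++_) (trans (cong₂ _++_ eq₁ eq₂) (lemma X₁ Q₁ X₂ Q₂)))
      where
      lemma : ∀ (a b c d : List Bool) → (a ++ b) ++ (c ++ d) ≡ (a ++ b ++ c) ++ d
      lemma a b c d = solve-monoid (++-monoid Bool)
    Q-long : ∀ Q → length Q ≡ q → a ≤ length Q
    Q-long Q len = subst (a ≤_) (sym len) a≤q
    -- The summand `m` in the plain part puts the upper bound of `Safe` in force before the late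
    -- blocks start.
    c₀-m : m ≤ length (A ++ colours c₀)
    c₀-m = ≤-trans (m≤n+m m a) (≤-trans (≤-reflexive (sym len₀)) (⊑-length (⊑-suffix A _)))
    c₁-long : a ≤ length (colours c₁)
    c₁-long = ≤-trans (Q-long Q₁ Q₁-len) (subst (λ x → length Q₁ ≤ length x) (sym eq₁) (⊑-length (⊑-suffix X₁ Q₁)))
    slack′ : ∀ X → length X ≡ t → a + suc n ≤ m + length X
    slack′ X len = subst (λ x → a + suc n ≤ m + x) (sym len) slack
    three-ones : 2 < ones (X₁ ++ Q₁ ++ X₂)
    three-ones = subst (2 <_) (sym (ones-++₃ X₁ Q₁ X₂)) (+-mono-≤
      (late-block-hit {A = A} {colours c₀} {X₁} {Q₁} (AtLeast-⊑ ⊑₁ dense) (≤-trans (m≤m+n a m) (≤-reflexive (sym len₀))) (Q-long Q₁ Q₁-len) c₀-m safe₁ crowded (slack′ X₁ X₁-len))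
      (+-mono-≤ (exists-one (AtLeast-⊑ (⊑-trans (subst (Q₁ ⊑_) (sym eq₁) (⊑-suffix X₁ Q₁)) (⊑-trans (⊑-prefix (colours c₁) _) ⊑₂)) dense) (Q-long Q₁ Q₁-len))
        (late-block-hit {A = A ++ colours c₀} {colours c₁} {X₂} {Q₂} (AtLeast-⊑ ⊑₂ dense) c₁-long (Q-long Q₂ Q₂-len) (≤-trans c₀-m (⊑-length (⊑-prefix (A ++ colours c₀) _))) safe₂ crowded (slack′ X₂ X₂-len))))

  -- Just before a one of X was inserted, the preceding entries, Q and the beginning of B
  -- formed a block of zeros of length m.
  late-block-missed : ∀ {n z A Y X Q B} → AtMost (suc n) 1 (Y ++ X ++ Q) → n ≤ length Y → length X + length Q ≤ suc n →
    1 ≤ length Q → (∀ p s → X ≡ p ++ s → Safe ((A ++ Y) ++ p ++ Q ++ B)) → Empty z B → m ≤ suc n + z → ones X ≡ 0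
  late-block-missed {n} {z} {A} {Y} {X} {Q} sparse Y-len XQ-len Q-len safe (u , v , refl , len , u-zero) m≤ = no-one X missed
    where
    missed : ∀ p s → X ≡ p ++ true ∷ s → ⊥
    -- `f` consists of the `n` entries directly before the supposed one. Sparseness around that one
    -- clears both `f` and `Q`.
    missed p s refl with split-at-end n (Y ++ p) (≤-trans Y-len (⊑-length (⊑-prefix Y p)))
    ... | e , f , eq , refl = contradiction (subst (1 ≤_) block-zero (proj₁ (safe p (true ∷ s) refl) block⊑ block-len)) λ ()
      where
      line≡ : Y ++ (p ++ true ∷ s) ++ Q ≡ (e ++ f) ++ true ∷ s ++ Q
      line≡ = trans (lemma Y p (true ∷ s) Q) (cong (_++ true ∷ s ++ Q) eq)
        where
        lemma : ∀ (a b c d : List Bool) → a ++ (b ++ c) ++ d ≡ (a ++ b) ++ (c ++ d)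
        lemma a b c d = solve-monoid (++-monoid Bool)
      f-zero : ones f ≡ 0
      f-zero = n≤0⇒n≡0 (≤-pred (subst (_≤ 1) (trans (ones-++ f (true ∷ [])) (+-comm (ones f) 1))
        (sparse {f ++ true ∷ []} (e , s ++ Q , trans line≡ (lemma e f (true ∷ []) (s ++ Q)))
          (≤-reflexive (trans (length-++ f {true ∷ []}) (+-comm (length f) 1))))))
        where
        lemma : ∀ (a b c d : List Bool) → (a ++ b) ++ c ++ d ≡ a ++ (b ++ c) ++ d
        lemma a b c d = solve-monoid (++-monoid Bool)
      Q-zero : ones Q ≡ 0
      Q-zero = n≤0⇒n≡0 (m+n≤o⇒n≤o (ones s) (≤-pred (subst (λ x → suc x ≤ 1) (ones-++ s Q)
        (sparse (subst ((true ∷ s ++ Q) ⊑_) (sym line≡) (⊑-suffix (e ++ f) _))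
          (≤-trans (≤-trans (≤-reflexive (length-++ (true ∷ s))) (+-monoˡ-≤ (length Q) (⊑-length (⊑-suffix p (true ∷ s))))) XQ-len)))))
      block = f ++ Q ++ u
      block⊑ : block ⊑ (A ++ Y) ++ p ++ Q ++ u ++ v
      block⊑ = A ++ e , v , trans (lemma A Y p (Q ++ u ++ v)) (trans (cong (λ x → A ++ x ++ Q ++ u ++ v) eq) (lemma′ A e f Q u v))
        where
        lemma : ∀ (a b c d : List Bool) → (a ++ b) ++ c ++ d ≡ a ++ (b ++ c) ++ d
        lemma a b c d = solve-monoid (++-monoid Bool)
        lemma′ : ∀ (a b c d e f : List Bool) → a ++ (b ++ c) ++ d ++ e ++ f ≡ (a ++ b) ++ (c ++ d ++ e) ++ f
        lemma′ a b c d e f = solve-monoid (++-monoid Bool)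
      block-len : m ≤ length block
      block-len = ≤-trans m≤ (subst (suc (length f) + z ≤_) (sym (length-++₃ f Q u))
        (by-slack 0 (+-mono-≤ Q-len len) (lemma (length f) z (length Q) (length u))))
        where
        lemma : ∀ f z q u → suc f + z + (q + u) + 0 ≡ f + (q + u) + (1 + z)
        lemma = solve-∀
      block-zero : ones block ≡ 0
      block-zero = trans (ones-++₃ f Q u) (cong₂ _+_ f-zero (cong₂ _+_ Q-zero u-zero))

  -- Only the last entries of the three blocks can be ones; two consecutive ones among them would be
  -- too close, and otherwise the zeros form too long a run.
  late-runs-beat-empty : ∀ {S a t z} → Beats S (Empty a) → Beats S (Crowded (suc (suc t)) 1) → a ≤ t + (1 + t) →
    m ≤ suc (suc t) + z → Beats (late-runs (suc t) t ▷ S) (Empty z)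
  late-runs-beat-empty {S} {a} {t} {z} beats-empty beats-crowded a≤ m≤ {A = A} {B = B} sv empty
    with ▷-survives {late-runs (suc t) t} {S} sv
  ... | c , line , res with ⨾-survives {plain (suc t)} {delayed t 1 ⨾ delayed t 1 ⨾ delayed t 1} line
  ... | c₀ , _ , refl , line₀ , line₁₂₃ with ⨾-survives {delayed t 1} {delayed t 1 ⨾ delayed t 1} line₁₂₃
  ... | c₁ , _ , refl , line₁ , line₂₃ with ⨾-survives {delayed t 1} {delayed t 1} line₂₃
  ... | c₂ , c₃ , refl , line₂ , line₃
    with plain-survives {suc t} line₀ | delayed-survives {t} {1} line₁ | delayed-survives {t} {1} line₂ | delayed-survives {t} {1} line₃
  ... | len₀ , _ | X₁ , Q₁ , eq₁ , X₁-len , Q₁-len , _ , safe₁ | X₂ , Q₂ , eq₂ , X₂-len , Q₂-len , _ , safe₂ | X₃ , Q₃ , eq₃ , X₃-len , Q₃-len , _ , safe₃ = conclude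
    where
    L = colours (c₀ ++ c₁ ++ c₂ ++ c₃)
    L≡ : L ≡ colours c₀ ++ colours c₁ ++ colours c₂ ++ colours c₃
    L≡ = trans (map-++ proj₂ c₀ _) (cong (colours c₀ ++_) (trans (map-++ proj₂ c₁ _) (cong (colours c₁ ++_) (map-++ proj₂ c₂ c₃))))
    dense : AtLeast a L
    dense = resists-dense {S} beats-empty res
    sparse : AtMost (suc (suc t)) 1 L
    sparse = resists-sparse {S} beats-crowded res
    in-L : ∀ {w} → w ⊑ (colours c₀ ++ colours c₁ ++ colours c₂ ++ colours c₃) → w ⊑ L
    in-L = subst (_ ⊑_) (sym L≡)
    ⊑₁ : (colours c₀ ++ X₁ ++ Q₁) ⊑ L
    ⊑₁ = subst (λ x → (colours c₀ ++ x) ⊑ L) eq₁ (in-L ([] , colours c₂ ++ colours c₃ , sym (++-assoc (colours c₀) _ _)))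
    ⊑₂ : (colours c₁ ++ X₂ ++ Q₂) ⊑ L
    ⊑₂ = subst (λ x → (colours c₁ ++ x) ⊑ L) eq₂ (in-L (⊑-++ˡ (colours c₀) ([] , colours c₃ , sym (++-assoc (colours c₁) _ _))))
    ⊑₃ : (colours c₂ ++ X₃ ++ Q₃) ⊑ L
    ⊑₃ = subst (λ x → (colours c₂ ++ x) ⊑ L) eq₃ (in-L (⊑-++ˡ (colours c₀) (⊑-suffix (colours c₁) _)))
    missed : ∀ {A} Y X Q → (Y ++ X ++ Q) ⊑ L → suc t ≤ length Y → length X ≡ t → length Q ≡ 1 →
      (∀ p s → X ≡ p ++ s → Safe ((A ++ Y) ++ p ++ Q ++ B)) → ones X ≡ 0
    missed {A} Y X Q ⊑L Y-len X-len Q-len safe = late-block-missed {A = A} {Y} {X} {Q} (λ w⊑ → sparse (⊑-trans w⊑ ⊑L)) Y-len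
      (≤-trans (≤-reflexive (trans (cong₂ _+_ X-len Q-len) (+-comm t 1))) (n≤1+n _)) (≤-reflexive (sym Q-len)) safe empty m≤
    block-len : ∀ {y} X Q → y ≡ X ++ Q → length X ≡ t → length Q ≡ 1 → suc t ≤ length y
    block-len X Q refl X-len Q-len = ≤-reflexive (sym (trans (length-++ X) (trans (cong₂ _+_ X-len Q-len) (+-comm t 1))))
    zero₁ = missed {A} (colours c₀) X₁ Q₁ ⊑₁ (≤-reflexive (sym len₀)) X₁-len Q₁-len safe₁
    zero₂ = missed {A ++ colours c₀} (colours c₁) X₂ Q₂ ⊑₂ (block-len X₁ Q₁ eq₁ X₁-len Q₁-len) X₂-len Q₂-len safe₂
    zero₃ = missed {(A ++ colours c₀) ++ colours c₁} (colours c₂) X₃ Q₃ ⊑₃ (block-len X₂ Q₂ eq₂ X₂-len Q₂-len) X₃-len Q₃-len safe₃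
    run-⊑ : ∀ {y} X Q X′ Q′ → y ≡ X ++ Q → (y ++ X′ ++ Q′) ⊑ L → (X ++ Q ++ X′) ⊑ L × (Q ++ X′ ++ Q′) ⊑ L
    run-⊑ X Q X′ Q′ refl ⊑L = ⊑-trans ([] , Q′ , lemma X Q X′ Q′) ⊑L , ⊑-trans (subst (_ ⊑_) (sym (++-assoc X Q _)) (⊑-suffix X _)) ⊑L
      where
      lemma : ∀ (a b c d : List Bool) → (a ++ b) ++ c ++ d ≡ (a ++ b ++ c) ++ d
      lemma a b c d = solve-monoid (++-monoid Bool)
    long-run : ∀ X Q X′ → (X ++ Q ++ X′) ⊑ L → length X ≡ t → length Q ≡ 1 → length X′ ≡ t → ones X ≡ 0 → ones Q ≡ 0 → ones X′ ≡ 0 → ⊥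
    long-run X Q X′ ⊑L X-len Q-len X′-len X-zero Q-zero X′-zero = <⇒≱
      (gap-short dense ⊑L (trans (ones-++₃ X Q X′) (cong₂ _+_ X-zero (cong₂ _+_ Q-zero X′-zero))))
      (≤-trans a≤ (≤-reflexive (sym (trans (length-++₃ X Q X′) (cong₂ _+_ X-len (cong₂ _+_ Q-len X′-len))))))
    -- The two single points and the late block between them have `t + 2` entries, the length within
    -- which `S` forbids two ones.
    close : ones Q₁ + (ones X₂ + ones Q₂) ≤ 1
    close = subst (_≤ 1) (ones-++₃ Q₁ X₂ Q₂) (sparse (proj₂ (run-⊑ X₁ Q₁ X₂ Q₂ eq₁ ⊑₂))
      (≤-reflexive (trans (length-++₃ Q₁ X₂ Q₂) (cong₂ _+_ Q₁-len (trans (cong₂ _+_ X₂-len Q₂-len) (+-comm t 1))))))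
    conclude : ⊥
    conclude with ones Q₁ in Q₁-zero | close
    ... | zero  | _ = long-run X₁ Q₁ X₂ (proj₁ (run-⊑ X₁ Q₁ X₂ Q₂ eq₁ ⊑₂)) X₁-len Q₁-len X₂-len zero₁ Q₁-zero zero₂
    ... | suc n | s≤s le = long-run X₂ Q₂ X₃ (proj₁ (run-⊑ X₂ Q₂ X₃ Q₃ eq₂ ⊑₃)) X₂-len Q₂-len X₃-len zero₂
      (n≤0⇒n≡0 (m+n≤o⇒n≤o (ones X₂) (m+n≤o⇒n≤o n le))) zero₃

  -- Two consecutive ones of the new row would have distance at most `a` and also at least `a + 1`,
  -- whatever the context is.
  plain-beats-all : ∀ {S a} → Beats S (Empty a) → Beats S (Crowded (suc (1 * a)) 1) → Beats (plain (2 * a) ▷ S) (λ _ → ⊤)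
  plain-beats-all {S} {a} beats-empty beats-crowded sv _ with ▷-survives {plain (2 * a)} {S} sv
  ... | c , line , res = too-dense 1 (resists-dense {S} beats-empty res) (resists-sparse {S} beats-crowded res)
    (≤-reflexive (sym (proj₁ (plain-survives {2 * a} line))))

-- Realisation by bottomless rectangles

safe-of-exact : ∀ {m l} → (∀ {w} → w ⊑ l → length w ≡ m → 1 ≤ ones w × ones w ≤ 3) → Safe m l
safe-of-exact {m} {l} exact = lower , upper
  where
  lower : AtLeast m l
  lower {w} w⊑l len = ≤-trans (proj₁ (exact (⊑-trans (⊑-take m w) w⊑l) (trans (length-take m w) (m≤n⇒m⊓n≡m len)))) (ones-mono (⊑-take m w))
  upper : m ≤ length l → AtMost m 3 l
  upper m≤ {w} (p , s , refl) len with extend p w s len m≤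
  ... | w′ , w⊑w′ , w′⊑l , len′ = ≤-trans (ones-mono w⊑w′) (proj₂ (exact w′⊑l len′))

natural : ℕ → ℚ
natural n = mkℚ (ℤ.+ n) 0 (coprime-sym (1-coprimeTo n))

natural-< : ∀ a b → (natural a ℚ.< natural b) ⇔ (a < b)
natural-< a b = mk⇔
  (λ { (ℚ.*<* lt) → ℤ.drop‿+<+ (subst₂ ℤ._<_ (ℤ.*-identityʳ (ℤ.+ a)) (ℤ.*-identityʳ (ℤ.+ b)) lt) })
  (λ lt → ℚ.*<* (subst₂ ℤ._<_ (sym (ℤ.*-identityʳ (ℤ.+ a))) (sym (ℤ.*-identityʳ (ℤ.+ b))) (+<+ lt)))

rect : ℕ × ℕ × ℕ → BottomlessRect
rect (a , b , t) = natural a , natural b , natural t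

between : ℕ → ℕ → ℕ → ℕ → ℕ → Bool
between a b t o u = does (a <? o) ∧ does (o <? b) ∧ does (u <? t)

inRect-between : ∀ a b t o u → inRect (rect (a , b , t)) (natural o , natural u) ≡ between a b t o u
inRect-between a b t o u = cong₂ _∧_ (lemma a o) (cong₂ _∧_ (lemma o b) (lemma u t))
  where
  lemma : ∀ x y → _ ≡ does (x <? y)
  lemma x y = trans (isYes≗does (natural x ℚ.<? natural y)) (does-⇔ (natural-< x y) (natural x ℚ.<? natural y) (x <? y))

cut : ℕ → ℕ → ℕ → ℕ → (l : List ℕ) → Subset (length l)
cut a b t o []      = []
cut a b t o (u ∷ l) = between a b t o u ∷ cut a b t (suc o) l

-- The abscissa is the position in the row, the ordinate the insertion time.
placed : ℕ → (l : List ℕ) → Vec Point (length l)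
placed o l = tabulate (λ i → natural (o + toℕ i) , natural (lookup (fromList l) i))

induced-placed : ∀ a b t o l → induced (placed o l) (rect (a , b , t)) ≡ cut a b t o l
induced-placed a b t o l = trans
  (tabulate-cong (λ i → trans (cong (inRect (rect (a , b , t))) (lookup∘tabulate _ i)) (inRect-between a b t (o + toℕ i) _)))
  (go o l)
  where
  go : ∀ o l → tabulate (λ i → between a b t (o + toℕ i) (lookup (fromList l) i)) ≡ cut a b t o l
  go o []      = refl
  go o (u ∷ l) = cong₂ _∷_ (cong (λ x → between a b t x u) (+-identityʳ o))
    (trans (tabulate-cong (λ i → cong (λ x → between a b t x (lookup (fromList l) i)) (+-suc o (toℕ i)))) (go (suc o) l))

placed-injective : ∀ o l {i j} → lookup (placed o l) i ≡ lookup (placed o l) j → i ≡ j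
placed-injective o l {i} {j} eq = toℕ-injective (+-cancelˡ-≡ o _ _ (ℤ.+-injective (cong (λ p → ℚ.ℚ.numerator (proj₁ p))
  (trans (sym (lookup∘tabulate _ i)) (trans eq (lookup∘tabulate _ j))))))

paint : (l : List ℕ) → Subset (length l) → Coloured
paint []      []      = []
paint (u ∷ l) (b ∷ U) = (u , b) ∷ paint l U

times-paint : ∀ l U → times (paint l U) ≡ l
times-paint []      []      = refl
times-paint (u ∷ l) (b ∷ U) = cong (u ∷_) (times-paint l U)

record CutsOut {n} (v U : Subset n) (w : List Bool) : Set where
  constructor cuts
  field
    size : ∣ v ∣ ≡ length w
    hits : ∣ v ∩ U ∣ ≡ ones w

skip : ∀ {n x c w} {v U : Subset n} → x ≡ false → CutsOut v U w → CutsOut (x ∷ v) (c ∷ U) w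
skip refl (cuts p q) = cuts p q

keep : ∀ {n x c w} {v U : Subset n} → x ≡ true → CutsOut v U w → CutsOut (x ∷ v) (c ∷ U) (c ∷ w)
keep {c = true}  refl (cuts p q) = cuts (cong suc p) (cong suc q)
keep {c = false} refl (cuts p q) = cuts (cong suc p) q

not-yet : ∀ {a b t o u} → t ≤ u → between a b t o u ≡ false
not-yet {a} {b} {t} {o} {u} t≤u rewrite dec-false (u <? t) (≤⇒≯ t≤u) | ∧-zeroʳ (does (o <? b)) = ∧-zeroʳ (does (a <? o))

nothing-cut : ∀ {a b t o} l U → b ≤ o → CutsOut (cut a b t o l) U []
nothing-cut []      []      b≤o = cuts refl refl
nothing-cut {a} {b} {t} {o} (u ∷ l) (c ∷ U) b≤o = skip right (nothing-cut l U (m≤n⇒m≤1+n b≤o))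
  where
  right : between a b t o u ≡ false
  right rewrite dec-false (o <? b) (≤⇒≯ b≤o) = ∧-zeroʳ (does (a <? o))

-- The right side `b` is the coordinate just behind the last point kept. Its bound keeps the
-- rectangle inside the finite family used later.
prefix-cut : ∀ {a t o} l U w s → a < o → state t (paint l U) ≡ w ++ s → ∃ λ b → o ≤ b × b ≤ o + length l × CutsOut (cut a b t o l) U w
prefix-cut {o = o} l U [] s a<o eq = o , ≤-refl , m≤m+n o _ , nothing-cut l U ≤-refl
prefix-cut [] [] (x ∷ w) s a<o ()
prefix-cut {a} {t} {o} (u ∷ l) (c ∷ U) (x ∷ w) s a<o eq with u <? t
... | no  u≮t with prefix-cut {a} {t} {suc o} l U (x ∷ w) s (m≤n⇒m≤1+n a<o) (trans (sym (state-new (paint l U) (≮⇒≥ u≮t))) eq)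
...   | b , o<b , b≤ , cs = b , <⇒≤ o<b , ≤-trans b≤ (≤-reflexive (sym (+-suc o _))) , skip (not-yet {a} {b} {t} {o} (≮⇒≥ u≮t)) cs
prefix-cut {a} {t} {o} (u ∷ l) (c ∷ U) (x ∷ w) s a<o eq | yes u<t with ∷-injective (trans (sym (state-old (paint l U) u<t)) eq)
... | refl , eq′ with prefix-cut {a} {t} {suc o} l U w s (m≤n⇒m≤1+n a<o) eq′
...   | b , o<b , b≤ , cs = b , <⇒≤ o<b , ≤-trans b≤ (≤-reflexive (sym (+-suc o _))) , keep inside cs
  where
  inside : between a b t o u ≡ true
  inside rewrite dec-true (a <? o) a<o | dec-true (o <? b) o<b = dec-true (u <? t) u<t

-- The left side `a` is the coordinate of the last present point skipped, or `o` if none is skipped.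
-- The row starts at `suc o` so that `o` is free for this.
block-cut : ∀ {t o} l U p w s → state t (paint l U) ≡ p ++ w ++ s →
  ∃₂ λ a b → o ≤ a × a ≤ o + length l × b ≤ suc o + length l × CutsOut (cut a b t (suc o) l) U w
block-cut {t} {o} l U [] w s eq with prefix-cut {o} {t} {suc o} l U w s ≤-refl eq
... | b , _ , b≤ , cs = o , b , ≤-refl , m≤m+n o _ , b≤ , cs
block-cut [] [] (x ∷ p) w s ()
block-cut {t} {o} (u ∷ l) (c ∷ U) (x ∷ p) w s eq with u <? t
... | no  u≮t with block-cut {t} {suc o} l U (x ∷ p) w s (trans (sym (state-new (paint l U) (≮⇒≥ u≮t))) eq)
...   | a , b , o<a , a≤ , b≤ , cs = a , b , <⇒≤ o<a , ≤-trans a≤ (≤-reflexive (sym (+-suc o _))) , ≤-trans b≤ (≤-reflexive (cong suc (sym (+-suc o _)))) , skip (not-yet {a} {b} {t} {suc o} (≮⇒≥ u≮t)) cs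
block-cut {t} {o} (u ∷ l) (c ∷ U) (x ∷ p) w s eq | yes u<t with block-cut {t} {suc o} l U p w s (proj₂ (∷-injective (trans (sym (state-old (paint l U) u<t)) eq)))
... | a , b , o<a , a≤ , b≤ , cs = a , b , <⇒≤ o<a , ≤-trans a≤ (≤-reflexive (sym (+-suc o _))) , ≤-trans b≤ (≤-reflexive (cong suc (sym (+-suc o _)))) , skip left cs
  where
  left : between a b t (suc o) u ≡ false
  left rewrite dec-false (a <? suc o) (≤⇒≯ o<a) = refl

-- Rectangles with natural corners in a bounded range already cut out every block of every state. A
-- shallow hitting set would thus be a surviving colouring between two empty contexts.
hypergraph-of : ∀ {m} → (∃ λ S → Beats m S (λ _ → ⊤)) → ∃ λ n → Σ (Vec Point n) λ pos → Σ (Hypergraph n) λ E →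
  InB pos E × ¬ (∃ λ (U : Subset n) → ShallowHittingSet 3 (sizeExactly m E) U)
hypergraph-of {m} (S , beats) = length l , pos , E , (placed-injective 1 l , All.map⁺ (All.universal (λ r → rect r , refl) boxes)) , unhit
  where
  l = schedule S 0
  pos = placed 1 l
  boxes : List (ℕ × ℕ × ℕ)
  boxes = cartesianProduct (upTo (suc (length l))) (cartesianProduct (upTo (suc (suc (length l)))) (upTo (suc (finish S 0))))
  E = map (λ r → induced pos (rect r)) boxes
  unhit : ¬ (∃ λ (U : Subset (length l)) → ShallowHittingSet 3 (sizeExactly m E) U)
  unhit (U , hitting) = beats {0} {[]} {paint l U} {[]} (survives (times-paint l U) (λ t _ t≤ → subst (Safe m) (sym (++-identityʳ _)) (safe-of-exact (exact t t≤)))) tt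
    where
    exact : ∀ t → t ≤ finish S 0 → ∀ {w} → w ⊑ state t (paint l U) → length w ≡ m → 1 ≤ ones w × ones w ≤ 3
    exact t t≤ (p , s , eq) len with block-cut {t} {0} l U p _ s eq
    ... | a , b , _ , a≤ , b≤ , cuts size hits = subst (λ x → 1 ≤ x × x ≤ 3) hits
      (hitting (cut a b t 1 l) (∈-filter⁺ (λ e → ∣ e ∣ ≟ m)
        (subst (_∈ E) (induced-placed a b t 1 l) (∈-map⁺ (λ r → induced pos (rect r)) (∈-cartesianProduct⁺ (∈-upTo⁺ (s≤s a≤)) (∈-cartesianProduct⁺ (∈-upTo⁺ (s≤s b≤)) (∈-upTo⁺ (s≤s t≤))))))
        (trans size len)))

-- Here h = 6 + g = ⌊m/2⌋ and H = ⌈m/2⌉.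
module _ (g H : ℕ) (6+g≤H : 6 + g ≤ H) (H≤7+g : H ≤ 7 + g) where

  private
    m = 6 + g + H

  -- Bootstrapping the distance bounds.

  Beatable : (List Bool → Set) → Set
  Beatable 𝒫 = ∃ λ S → Beats m S 𝒫

  three-beatable : Beatable (Crowded (5 + g + H) 2)
  three-beatable = plain (m + m) , plain-beats-crowded m ≤-refl

  run-H+1-beatable : Beatable (Crowded (5 + g + H) 2) → Beatable (Empty (suc H))
  run-H+1-beatable (S , beats) = plain (3 * (5 + g)) ▷ S ,
    -- Here `w = h - 1` and `z = H + 1` add up to `m`, and `2 * w + 1` is at most `m - 1` because
    -- `h ≤ H`.
    plain-beats-empty m {S} {5 + g} (beats-crowded-≤ m {S} (by-slack 0 6+g≤H (eq g H)) beats) (≤-reflexive (sym (+-suc (5 + g) H)))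
    where
    eq : ∀ g H → suc (2 * (5 + g)) + H + 0 ≡ 5 + g + H + (6 + g)
    eq = solve-∀

  pair-h-beatable : Beatable (Crowded (5 + g + H) 2) → Beatable (Empty (suc H)) → Beatable (Crowded (6 + g) 1)
  pair-h-beatable (S , beats) (S′ , beats′) = late-blocks (suc H + m) 2 (suc H) ▷ (S ⨾ S′) ,
    late-blocks-beat-crowded m {S ⨾ S′} {suc H} {5 + g + H} {2} {suc H} (beats-⨾ʳ m {S} {S′} beats′)
      (resists-sparse m {S ⨾ S′} (beats-⨾ˡ m {S} {S′} beats))
      -- The window of `H + 5` entries has to fit into `m - 1 = h + H - 1`. This is the bound
      -- `h ≥ 6`, that is `m ≥ 12`, with no slack at `g = 0`.
      ≤-refl (by-slack g z≤n (eq₁ g H)) (≤-reflexive (eq₂ g H))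
    where
    eq₁ : ∀ g H → 2 + (suc H + 2) + 0 + g ≡ 5 + g + H + 0
    eq₁ = solve-∀
    eq₂ : ∀ g H → suc H + suc (6 + g) ≡ 6 + g + H + 2
    eq₂ = solve-∀

  run-H-beatable : Beatable (Empty (suc H)) → Beatable (Crowded (6 + g) 1) → Beatable (Empty H)
  run-H-beatable (S , beats) (S′ , beats′) = late-runs (5 + g) (4 + g) ▷ (S ⨾ S′) ,
    late-runs-beat-empty m {S ⨾ S′} {suc H} {4 + g} (beats-⨾ˡ m {S} {S′} beats) (beats-⨾ʳ m {S} {S′} beats′)
      -- Two late blocks of `h - 2` zeros and the point between them make `2h - 3` zeros, at least
      -- the forbidden `H + 1`.
      (by-slack (1 + g) H≤7+g (eq g H)) ≤-refl
    where
    eq : ∀ g H → suc H + (7 + g) + (1 + g) ≡ 4 + g + (1 + (4 + g)) + H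
    eq = solve-∀

  pair-h+1-beatable : Beatable (Empty H) → Beatable (Crowded (6 + g) 1) → Beatable (Crowded (7 + g) 1)
  pair-h+1-beatable (S , beats) (S′ , beats′) = late-blocks (H + m) 2 H ▷ (S ⨾ S′) ,
    late-blocks-beat-crowded m {S ⨾ S′} {H} {6 + g + (6 + g)} {2} {H} (beats-⨾ˡ m {S} {S′} beats)
      (λ res → AtMost-double (resists-sparse m {S ⨾ S′} (beats-⨾ʳ m {S} {S′} beats′) res))
      ≤-refl (by-slack (1 + g) H≤7+g (eq₁ g H)) (≤-reflexive (eq₂ g H))
    where
    eq₁ : ∀ g H → 2 + (H + 2) + (7 + g) + (1 + g) ≡ 6 + g + (6 + g) + H
    eq₁ = solve-∀
    eq₂ : ∀ g H → H + suc (7 + g) ≡ 6 + g + H + 2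
    eq₂ = solve-∀

  pair-h+2-beatable : Beatable (Empty H) → Beatable (Crowded (7 + g) 1) → Beatable (Crowded (8 + g) 1)
  pair-h+2-beatable (S , beats) (S′ , beats′) = late-blocks (H + m) 3 H ▷ (S ⨾ S′) ,
    late-blocks-beat-crowded m {S ⨾ S′} {H} {7 + g + (7 + g)} {3} {H} (beats-⨾ˡ m {S} {S′} beats)
      -- The window now has `H + 6` entries, which can exceed `2h`; the distance `h + 1` gained
      -- before provides room for `2h + 2`.
      (λ res → AtMost-double (resists-sparse m {S ⨾ S′} (beats-⨾ʳ m {S} {S′} beats′) res))
      ≤-refl (by-slack (1 + g) H≤7+g (eq₁ g H)) (≤-reflexive (eq₂ g H))
    where
    eq₁ : ∀ g H → 3 + (H + 3) + (7 + g) + (1 + g) ≡ 7 + g + (7 + g) + H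
    eq₁ = solve-∀
    eq₂ : ∀ g H → H + suc (8 + g) ≡ 6 + g + H + 3
    eq₂ = solve-∀

  all-beatable : Beatable (Empty H) → Beatable (Crowded (8 + g) 1) → Beatable (λ _ → ⊤)
  all-beatable (S , beats) (S′ , beats′) = plain (2 * H) ▷ (S ⨾ S′) ,
    plain-beats-all m {S ⨾ S′} {H} (beats-⨾ˡ m {S} {S′} beats)
      -- The bounds become contradictory since `H + 1 ≤ h + 2`.
      (beats-crowded-≤ m {S ⨾ S′} (s≤s (≤-trans (≤-reflexive (*-identityˡ H)) H≤7+g)) (beats-⨾ʳ m {S} {S′} beats′))

  everything-beatable : Beatable (λ _ → ⊤)
  everything-beatable = all-beatable run-H (pair-h+2-beatable run-H (pair-h+1-beatable run-H pair-h))
    where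
    run-H+1 = run-H+1-beatable three-beatable
    pair-h  = pair-h-beatable three-beatable run-H+1
    run-H   = run-H-beatable run-H+1 pair-h

halves : ∀ m → 12 ≤ m → ∃₂ λ g H → 6 + g ≤ H × H ≤ 7 + g × 6 + g + H ≡ m
halves m 12≤m with m≤n⇒∃[o]m+o≡n (⌊n/2⌋-mono 12≤m)
... | g , eq = g , ⌈ m /2⌉ ,
  subst (_≤ ⌈ m /2⌉) (sym eq) (⌊n/2⌋≤⌈n/2⌉ m) ,
  -- By computation, `⌈ m /2⌉` is the lower half of `suc m`, and one more than the lower half of `m`
  -- is that of `suc (suc m)`.
  subst (λ x → ⌈ m /2⌉ ≤ suc x) (sym eq) (⌊n/2⌋-mono (n≤1+n (suc m))) ,
  trans (cong (_+ ⌈ m /2⌉) eq) (⌊n/2⌋+⌈n/2⌉≡n m)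

theorem1 : (m : ℕ) → 12 ≤ m →
    ∃ λ n → Σ (Vec Point n) λ pos → Σ (Hypergraph n) λ E →
    InB pos E × ¬ (∃ λ (U : Subset n) → ShallowHittingSet 3 (sizeExactly m E) U)
theorem1 m 12≤m with halves m 12≤m
... | g , H , lo , hi , refl = hypergraph-of (everything-beatable g H lo hi)
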